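{- Let $q$ be a prime power, let $n\ge 0$ be an integer, let $r,s$ be positive integers, and let $C(x)\in\mathbb{F}_{q^2}[x]$ be a self-conjugate reciprocal (SCR) polynomial of degree $n$. Let $B(x)\in\mathbb{F}_{q^2}[x]$ be such that $B(x)$ has no root in $\mu_{q+1}$ and the map $x\mapsto x^{r}B^{(q)}(1/x)/B(x)$ permutes $\mu_{q+1}$. Suppose $s\equiv r+n \pmod{q+1}$. Then $x^{s}B(x^{q-1})C(x^{q-1})$ permutes $\mathbb{F}_{q^2}$ if and only if $\gcd(s,q-1)=1$ and $C(x)$ has no root in $\mu_{q+1}$.
   Context: $\mu_{q+1}$ denotes the set of $(q+1)$-th roots of unity in $\mathbb{F}_{q^2}$. For $B(x)\in\mathbb{F}_{q^2}[x]$, $B^{(q)}(x)$ denotes the polynomial obtained from $B(x)$ by raising every coefficient to the $q$-th power. A nonzero polynomial $C(x)\in\mathbb{F}_{q^2}[x]$ of degree $n$ is self-conjugate reciprocal (SCR) if $x^{n}C^{(q)}(1/x)=\beta C(x)$ for some $\beta\in\mathbb{F}_{q^2}$. A polynomial permutes a finite set if it induces a bijection of that set onto itself. -}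

module Defs where

open import Algebra.Bundles using (CommutativeRing)
import Algebra.Properties.Semiring.Exp as Exp
open import Data.Fin.Base using (Fin)
open import Data.List.Base using (List; []; _∷_; map; replicate; _++_; applyUpTo)
open import Data.Nat.Base using (ℕ; zero; suc; _∸_; _≤_; _<_) renaming (_^_ to _^ℕ_)
open import Data.Nat.Primality using (Prime)
import Data.Product.Base as Product
open import Data.Product.Base using (Σ; ∃-syntax; _×_; proj₁)
open import Function.Base using (_on_)
open import Function.Bundles using (Inverse)
open import Function.Definitions using (Bijective)
open import Level using (Level; _⊔_) renaming (suc to lsuc)
open import Relation.Binary.PropositionalEquality using (_≡_; setoid)
open import Relation.Nullary.Negation using (¬_)
open import Relation.Unary using (Pred; U)

IsPrimePower : ℕ → Set
IsPrimePower q = ∃[ p ] ∃[ k ] Prime p × 1 ≤ k × q ≡ p ^ℕ k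

-- A field with exactly N elements up to _≈_.  Having finitely many elements
-- makes _≈_ decidable, so _≉_ is an adequate notion of being nonzero and a
-- total inverse operation exists.  The value 0# ⁻¹ is left unspecified.
record FiniteField c ℓ (N : ℕ) : Set (lsuc (c ⊔ ℓ)) where
  infix 8 _⁻¹
  field
    commutativeRing : CommutativeRing c ℓ

  open CommutativeRing commutativeRing public renaming (setoid to ≈-setoid)

  field
    0≉1         : 0# ≉ 1#
    _⁻¹         : Carrier → Carrier
    ⁻¹-cong     : ∀ {x y} → x ≈ y → x ⁻¹ ≈ y ⁻¹
    ⁻¹-inverse  : ∀ x → x ≉ 0# → x * x ⁻¹ ≈ 1#
    enumeration : Inverse ≈-setoid (setoid (Fin N))

  open Exp semiring public using (_^_)

  infixl 7 _/_
  _/_ : Carrier → Carrier → Carrier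
  x / y = x * y ⁻¹

module FieldTheory {c ℓ : Level} {N : ℕ} (F : FiniteField c ℓ N) where
  open FiniteField F

  -- The roots of unity in F whose order divides k.
  μ : ℕ → Pred Carrier ℓ
  μ k x = x ^ k ≈ 1#

  Permutes : ∀ {p} → (Carrier → Carrier) → Pred Carrier p → Set (c ⊔ ℓ ⊔ p)
  Permutes f S =
    Σ (∀ {x} → S x → S (f x)) λ f-maps →
      Bijective {A = Σ Carrier S} {B = Σ Carrier S}
        (_≈_ on proj₁) (_≈_ on proj₁) (Product.map f f-maps)

  -- Coefficient lists, constant term first.  Trailing zeros are allowed, so
  -- equality of polynomials is _≋_ rather than _≡_.
  Poly : Set c
  Poly = List Carrier

  coeff : Poly → ℕ → Carrier
  coeff []      _       = 0#
  coeff (a ∷ P) zero    = a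
  coeff (a ∷ P) (suc i) = coeff P i

  infix 4 _≋_
  _≋_ : Poly → Poly → Set ℓ
  P ≋ Q = ∀ i → coeff P i ≈ coeff Q i

  HasDegree : Poly → ℕ → Set ℓ
  HasDegree P n = coeff P n ≉ 0# × (∀ i → n < i → coeff P i ≈ 0#)

  eval : Poly → Carrier → Carrier
  eval []      x = 0#
  eval (a ∷ P) x = a + x * eval P x

  NoRootIn : ∀ {p} → Poly → Pred Carrier p → Set (c ⊔ ℓ ⊔ p)
  NoRootIn P S = ∀ x → S x → ¬ (eval P x ≈ 0#)

  infixl 6 _+ₚ_
  infixl 7 _*ₚ_
  infixr 7 _·ₚ_
  infixr 8 _∘ₚ_

  _+ₚ_ : Poly → Poly → Poly
  []      +ₚ Q       = Q
  (a ∷ P) +ₚ []      = a ∷ P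
  (a ∷ P) +ₚ (b ∷ Q) = (a + b) ∷ (P +ₚ Q)

  _·ₚ_ : Carrier → Poly → Poly
  a ·ₚ P = map (a *_) P

  _*ₚ_ : Poly → Poly → Poly
  []      *ₚ Q = []
  (a ∷ P) *ₚ Q = (a ·ₚ Q) +ₚ (0# ∷ (P *ₚ Q))

  -- P ∘ₚ Q is P(Q(x)).
  _∘ₚ_ : Poly → Poly → Poly
  []      ∘ₚ Q = []
  (a ∷ P) ∘ₚ Q = (a ∷ []) +ₚ (Q *ₚ (P ∘ₚ Q))

  X^ : ℕ → Poly
  X^ k = replicate k 0# ++ (1# ∷ [])

  -- P ⁽ q ⁾ raises every coefficient of P to the q-th power.
  infix 9 _⁽_⁾
  _⁽_⁾ : Poly → ℕ → Poly
  P ⁽ q ⁾ = map (_^ q) P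

  -- xⁿ P(1/x) for P of degree at most n: if P = Σ cᵢ xⁱ, this is Σ cᵢ xⁿ⁻ⁱ,
  -- whose coefficient at xⁱ is cₙ₋ᵢ for i ≤ n.
  reciprocal : ℕ → Poly → Poly
  reciprocal n P = applyUpTo (λ i → coeff P (n ∸ i)) (suc n)

  -- C is self-conjugate reciprocal of degree n.
  IsSCR : ℕ → ℕ → Poly → Set (c ⊔ ℓ)
  IsSCR q n C = HasDegree C n × ∃[ β ] reciprocal n (C ⁽ q ⁾) ≋ β ·ₚ C

  PermutesField : Poly → Set (c ⊔ ℓ)
  PermutesField P = Permutes (eval P) U

{-# OPTIONS --safe #-}

-- Write f for the polynomial xˢB(xᑫ⁻¹)C(xᑫ⁻¹) and h(u) = uʳB⁽ᑫ⁾(1/u)/B(u).  On μ_{q+1} Frobenius gives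
-- B⁽ᑫ⁾(1/u) = B(u)ᑫ, and self-conjugate reciprocity of C gives uⁿC(u)ᑫ⁻¹ = β whenever C(u) ≠ 0.  As
-- s ≡ r + n modulo q + 1, this yields f(x)ᑫ⁻¹ = β h(xᑫ⁻¹) for nonzero x.  So f(x) determines xᑫ⁻¹, hence
-- also xˢ, and these determine x when gcd(s, q - 1) = 1.  Conversely, a common divisor d > 1 of s and
-- q - 1 gives some ζ ≠ 1 with ζᵈ = 1, so f(ζ) = f(1); and a root u = xᑫ⁻¹ of C in μ_{q+1} gives f(x) = f(0).
module Submission where

open import Defs
open import Data.Nat.Base using (ℕ; suc; _+_; _∸_; _<_; _^_)
open import Data.Nat.DivMod using (_%_)
open import Data.Nat.GCD using (gcd)
open import Data.Product.Base using (_×_)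
open import Function.Bundles using (_⇔_)
open import Relation.Binary.PropositionalEquality using (_≡_)

open import Algebra.Bundles using (CommutativeMonoid)
import Algebra.Properties.AbelianGroup as AbelianGroupProperties
import Algebra.Properties.CommutativeMonoid.Sum as MonoidSum
import Algebra.Properties.CommutativeSemiring.Binomial as Binomial
import Algebra.Properties.CommutativeSemiring.Exp as Exp
import Algebra.Properties.Monoid.Mult as MonoidMult
import Algebra.Properties.Ring as RingProperties
import Algebra.Properties.Semiring.Mult as SemiringMult
import Algebra.Solver.Ring.NaturalCoefficients.Default as SemiringSolver
open import Data.Empty using (⊥-elim)
open import Data.Fin.Base as Fin using (Fin; zero; suc; toℕ; fromℕ; inject₁; punchIn; punchOut)
open import Data.Fin.Permutation using (Permutation′; permutation)
import Data.Fin.Properties as Fin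
open import Data.List.Base using ([]; _∷_; replicate; length; take)
open import Data.List.Properties using (length-map; length-++; length-replicate)
open import Data.List.Relation.Unary.All as All using (All; []; _∷_)
open import Data.Nat.Base as ℕ using (zero; _≤_; _!; z≤n; s≤s; z<s)
open import Data.Nat.Combinatorics using (nCn≡1; nCk≡n!/k![n-k]!; k![n∸k]!∣n!) renaming (_C_ to _choose_)
open import Data.Nat.Divisibility using (_∣_; divides; ∣⇒≤; m∣m*n; n∣m*n; ∣1⇒≡1)
open import Data.Nat.DivMod using (m/n*n≡m; m≡m%n+[m/n]*n)
open import Data.Nat.GCD using (gcd[m,n]∣m; gcd[m,n]∣n; gcd-GCD; GCD; module Bézout)
open import Data.Nat.Primality using (Prime; euclidsLemma; prime⇒nonTrivial; prime⇒nonZero)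
import Data.Nat.Properties as ℕ
open import Data.Nat.Solver using (module +-*-Solver)
open import Data.Product.Base using (∃-syntax; _,_; proj₁; proj₂)
open import Data.Sum.Base using (inj₁; inj₂)
open import Data.Vec.Functional using (Vector; removeAt)
open import Function.Base using (_∘_; _$_)
open import Function.Bundles using (Inverse; mk⇔)
open import Function.Definitions using (Injective)
open import Level using (Level)
open import Relation.Binary.Definitions using (Decidable)
import Relation.Binary.PropositionalEquality as ≡
open import Relation.Binary.PropositionalEquality using (_≢_)
import Relation.Binary.Reasoning.Setoid as SetoidReasoning
open import Relation.Nullary using (¬_; Dec; yes; no; contradiction)
open import Relation.Nullary.Decidable using (map′; decidable-stable)
open import Relation.Unary using (U)

-- The field is given only by its operations and an enumeration, so its characteristic, `x^N = x`
-- and the roots of unity all have to be extracted from counting. The first two come from one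
-- device: translation by 1 permutes the elements and fixes their sum; scaling by a nonzero `a`
-- permutes the nonzero ones and fixes their product. Cyclicity of the unit group is never invoked.
-- The element ζ of the overview, and an `x` with `x^(q-1) = u` for a given `u` in μ_{q+1}, both
-- come from one root count: `x + b x^(k+2)` with `k + 2 < N` cannot vanish on the whole field. The
-- choice `b = -1` yields ζ as a power of `x`; the choice `b = u^q` yields the preimage of `u`. That
-- preimage is what makes a root of C in μ_{q+1} visible to f, which evaluates C only at `(q-1)`-th
-- powers. Passing from `β h(u) = β h(v)` to `u = v` also takes `β ≠ 0`. This is read off from
-- `u^n C(u)^(q-1) = β` at any `u` in μ_{q+1} where C does not vanish.

private
  variable
    c ℓ : Level

-- Primes in binomial coefficients, and maps of finite sets

prime∣!⇒≤ : ∀ {p} → Prime p → ∀ k → p ∣ k ! → p ≤ k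
prime∣!⇒≤ {p} pr zero    p∣1 =
  contradiction (∣1⇒≡1 p∣1) (ℕ.nonTrivial⇒≢1 ⦃ prime⇒nonTrivial pr ⦄)
prime∣!⇒≤ {p} pr (suc k) p∣  with euclidsLemma (suc k) (k !) pr p∣
... | inj₁ p∣1+k = ∣⇒≤ p∣1+k
... | inj₂ p∣k!  = ℕ.m≤n⇒m≤1+n (prime∣!⇒≤ pr k p∣k!)

nCk*k![n∸k]!≡n! : ∀ {n k} → k ≤ n → (n choose k) ℕ.* (k ! ℕ.* (n ∸ k) !) ≡ n !
nCk*k![n∸k]!≡n! {n} {k} k≤n =
  ≡.trans (≡.cong (ℕ._* (k ! ℕ.* (n ∸ k) !)) (nCk≡n!/k![n-k]! k≤n)) (m/n*n≡m (k![n∸k]!∣n! k≤n))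
  where instance _ = k ℕ.!* (n ∸ k) !≢0

-- All prime factors of `k !` and `(p ∸ k) !` are below `p`, so in
-- `p ! = (p choose k) * (k ! * (p ∸ k) !)` the factor `p` can only sit in the binomial coefficient.
prime∣pCk : ∀ {p} → Prime p → ∀ {k} → 0 < k → k < p → p ∣ (p choose k)
prime∣pCk {p@(suc p-1)} pr {k@(suc k-1)} 0<k k<p
  with euclidsLemma (p choose k) (k ! ℕ.* (p ∸ k) !) pr p∣product
  where
  p∣product : p ∣ (p choose k) ℕ.* (k ! ℕ.* (p ∸ k) !)
  p∣product = ≡.subst (p ∣_) (≡.sym (nCk*k![n∸k]!≡n! (ℕ.<⇒≤ k<p))) (m∣m*n (p-1 !))
... | inj₁ p∣pCk = p∣pCk
... | inj₂ p∣k![p∸k]! with euclidsLemma (k !) ((p ∸ k) !) pr p∣k![p∸k]!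
...   | inj₁ p∣k!     = contradiction (prime∣!⇒≤ pr k p∣k!) (ℕ.<⇒≱ k<p)
...   | inj₂ p∣[p∸k]! =
  contradiction (prime∣!⇒≤ pr (p ∸ k) p∣[p∸k]!) (ℕ.<⇒≱ (s≤s (ℕ.m∸n≤m p-1 k-1)))

-- Pigeonhole: a missed value could be punched out of the codomain, leaving an injection from
-- `Fin (suc n)` into `Fin n`.
injective⇒surjective : ∀ {n} {f : Fin n → Fin n} → Injective _≡_ _≡_ f → ∀ y → ∃[ x ] f x ≡ y
injective⇒surjective {suc n} {f} f-injective y with Fin.any? (λ x → f x Fin.≟ y)
... | yes x,fx≡y = x,fx≡y
... | no ∄x      =
  contradiction (Fin.injective⇒≤ {f = λ x → punchOut (y≢f x)} punch-injective) (ℕ.n≮n n)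
  where
  y≢f : ∀ x → y ≢ f x
  y≢f x y≡fx = ∄x (x , ≡.sym y≡fx)

  punch-injective : Injective _≡_ _≡_ (λ x → punchOut (y≢f x))
  punch-injective eq = f-injective (Fin.punchOut-injective (y≢f _) (y≢f _) eq)

module _ (M : CommutativeMonoid c ℓ) where
  open CommutativeMonoid M
  open MonoidSum M using (sum; sum-remove; sum-replicate; sum-cong-≋)
  open MonoidMult monoid renaming (_×_ to _×ₙ_)
  open SetoidReasoning setoid

  -- The extra `a` on the left fills the gap at `i`, so that the multiplicity is `n` and no
  -- predecessor appears. Used multiplicatively, with `i` the index of zero, to recognise `a ^ᶠ N`.
  sum-const-but-one : ∀ {n} (i : Fin n) {a} (t : Vector Carrier n) →
                      t i ≈ ε → (∀ j → j ≢ i → t j ≈ a) → a ∙ sum t ≈ n ×ₙ a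
  sum-const-but-one {suc n} i {a} t tᵢ≈ε t≈a = ∙-congˡ $ begin
    sum t                      ≈⟨ sum-remove {i = i} t ⟩
    t i ∙ sum (removeAt t i)   ≈⟨ ∙-congʳ tᵢ≈ε ⟩
    ε ∙ sum (removeAt t i)     ≈⟨ identityˡ _ ⟩
    sum (removeAt t i)         ≈⟨ sum-cong-≋ (λ j → t≈a (punchIn i j) (Fin.punchInᵢ≢i i j)) ⟩
    sum {n} (λ _ → a)          ≈⟨ sum-replicate n ⟩
    n ×ₙ a                     ∎

-- Decidability, finite search and cancellation in a finite field

module FiniteFieldProperties {N} (F : FiniteField c ℓ N) where
  open FiniteField F
    renaming (_^_ to _^ᶠ_; _+_ to _+ᶠ_; _*_ to _*ᶠ_; refl to ≈-refl; sym to ≈-sym; trans to ≈-trans; zero to *-zero)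
  open Inverse enumeration
  open RingProperties ring using (-‿distribʳ-*; -1*x≈-x)
  open AbelianGroupProperties +-abelianGroup using ()
    renaming (x∙y⁻¹≈ε⇒x≈y to x-y≈0⇒x≈y; ∙-cancelʳ to +-cancelʳ)
  open Exp commutativeSemiring using (^-congˡ; ^-congʳ; ^-homo-*; ^-assocʳ; ^-distrib-*)
  open SemiringMult semiring using (×1-homo-*; ×-assoc-*; ×-congʳ) renaming (_×_ to _×ₙ_)
  open SemiringSolver commutativeSemiring using (solve; _:=_; _:+_; _:*_)
  module Reasoning = SetoidReasoning ≈-setoid
  open Reasoning

  from-to : ∀ x → from (to x) ≈ x
  from-to x = inverseʳ ≡.refl

  to-injective : ∀ {x y} → to x ≡ to y → x ≈ y
  to-injective {x} {y} eq = ≈-trans (≈-sym (from-to x)) (inverseʳ eq)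

  from-injective : Injective _≡_ _≈_ from
  from-injective {i} {j} eq = ≡.trans (≡.sym (inverseˡ {i} ≈-refl)) (inverseˡ eq)

  infix 4 _≟_
  _≟_ : Decidable _≈_
  x ≟ y = map′ to-injective to-cong (to x Fin.≟ to y)

  ¬∀⇒∃¬ : ∀ {p} {P : Carrier → Set p} → (∀ x → Dec (P x)) → (∀ {x y} → x ≈ y → P x → P y) →
          ¬ (∀ x → P x) → ∃[ x ] ¬ P x
  ¬∀⇒∃¬ {P = P} P? P-resp ¬∀P
    with i , ¬Pi ← Fin.¬∀⟶∃¬ N (P ∘ from) (P? ∘ from) (λ ∀P → ¬∀P (λ x → P-resp (from-to x) (∀P (to x))))
    = from i , ¬Pi

  injective⇒surjectiveᶠ : (f : Carrier → Carrier) → (∀ {x y} → x ≈ y → f x ≈ f y) →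
                          (∀ {x y} → f x ≈ f y → x ≈ y) → ∀ y → ∃[ x ] f x ≈ y
  injective⇒surjectiveᶠ f f-cong f-injective y
    with i , eq ← injective⇒surjective {f = to ∘ f ∘ from} (from-injective ∘ f-injective ∘ to-injective) (to y)
    = from i , to-injective eq

  *-cancelˡ-0 : ∀ {x y} → x ≉ 0# → x *ᶠ y ≈ 0# → y ≈ 0#
  *-cancelˡ-0 {x} {y} x≉0 xy≈0 = begin
    y                     ≈⟨ *-identityˡ y ⟨
    1# *ᶠ y               ≈⟨ *-congʳ (⁻¹-inverse x x≉0) ⟨
    x *ᶠ x ⁻¹ *ᶠ y        ≈⟨ solve 3 (λ a b c → a :* b :* c := b :* (a :* c)) ≈-refl x (x ⁻¹) y ⟩
    x ⁻¹ *ᶠ (x *ᶠ y)      ≈⟨ *-congˡ xy≈0 ⟩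
    x ⁻¹ *ᶠ 0#            ≈⟨ zeroʳ _ ⟩
    0#                    ∎

  *-cancelˡ : ∀ {x y z} → x ≉ 0# → x *ᶠ y ≈ x *ᶠ z → y ≈ z
  *-cancelˡ {x} {y} {z} x≉0 xy≈xz = x-y≈0⇒x≈y _ _ $ *-cancelˡ-0 x≉0 $ begin
    x *ᶠ (y - z)           ≈⟨ distribˡ x y (- z) ⟩
    x *ᶠ y +ᶠ x *ᶠ - z     ≈⟨ +-cong xy≈xz (≈-sym (-‿distribʳ-* x z)) ⟩
    x *ᶠ z - x *ᶠ z        ≈⟨ -‿inverseʳ _ ⟩
    0#                     ∎

  *-cancelʳ : ∀ {x y z} → x ≉ 0# → y *ᶠ x ≈ z *ᶠ x → y ≈ z
  *-cancelʳ x≉0 yx≈zx = *-cancelˡ x≉0 (≈-trans (*-comm _ _) (≈-trans yx≈zx (*-comm _ _)))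

  *-nonzero : ∀ {x y} → x ≉ 0# → y ≉ 0# → x *ᶠ y ≉ 0#
  *-nonzero x≉0 y≉0 = y≉0 ∘ *-cancelˡ-0 x≉0

  ^-nonzero : ∀ {x} n → x ≉ 0# → x ^ᶠ n ≉ 0#
  ^-nonzero zero    x≉0 = 0≉1 ∘ ≈-sym
  ^-nonzero (suc n) x≉0 = *-nonzero x≉0 (^-nonzero n x≉0)

  ^≈0⇒≈0 : ∀ {x} n → x ^ᶠ n ≈ 0# → x ≈ 0#
  ^≈0⇒≈0 {x} n xⁿ≈0 = decidable-stable (x ≟ 0#) (λ x≉0 → ^-nonzero n x≉0 xⁿ≈0)

  ^≈1⇒≉0 : ∀ {x} n → x ^ᶠ suc n ≈ 1# → x ≉ 0#
  ^≈1⇒≉0 {x} n eq x≈0 = 0≉1 $ begin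
    0#               ≈⟨ zeroˡ _ ⟨
    0# *ᶠ x ^ᶠ n     ≈⟨ *-congʳ x≈0 ⟨
    x ^ᶠ suc n       ≈⟨ eq ⟩
    1#               ∎

  1^n≈1 : ∀ n → 1# ^ᶠ n ≈ 1#
  1^n≈1 zero    = ≈-refl
  1^n≈1 (suc n) = ≈-trans (*-identityˡ _) (1^n≈1 n)

  -- Sums and products over all elements: `N ×ₙ 1# ≈ 0#` and `x ^ᶠ N ≈ x`

  module _ (M : CommutativeMonoid c ℓ) where
    private module M = CommutativeMonoid M
    open MonoidSum M using (sum; sum-permute; sum-cong-≋)

    -- Kept over an arbitrary commutative monoid so that it serves both the additive sum under
    -- translation and the product under scaling.
    sum-reindex : (φ φ⁻¹ : Carrier → Carrier) →
                  (∀ {x y} → x ≈ y → φ x ≈ φ y) → (∀ {x y} → x ≈ y → φ⁻¹ x ≈ φ⁻¹ y) →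
                  (∀ x → φ (φ⁻¹ x) ≈ x) → (∀ x → φ⁻¹ (φ x) ≈ x) →
                  (h : Carrier → M.Carrier) → (∀ {x y} → x ≈ y → h x M.≈ h y) →
                  sum (h ∘ from) M.≈ sum (h ∘ φ ∘ from)
    sum-reindex φ φ⁻¹ φ-cong φ⁻¹-cong φφ⁻¹ φ⁻¹φ h h-cong =
      M.trans (sum-permute (h ∘ from) π) (sum-cong-≋ (λ i → h-cong (from-to (φ (from i)))))
      where
      π : Permutation′ N
      π = permutation (to ∘ φ ∘ from) (to ∘ φ⁻¹ ∘ from)
        (λ i → inverseˡ (≈-trans (φ-cong (from-to _)) (φφ⁻¹ (from i))))
        (λ i → inverseˡ (≈-trans (φ⁻¹-cong (from-to _)) (φ⁻¹φ (from i))))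

  -- Adding `1#` to every element permutes the field, hence preserves the sum of all elements, yet
  -- raises it by `N ×ₙ 1#`.
  N×1≈0 : N ×ₙ 1# ≈ 0#
  N×1≈0 = +-cancelʳ (sum from) _ _ $ begin
    N ×ₙ 1# +ᶠ sum from                ≈⟨ +-congʳ (sum-replicate N) ⟨
    sum {N} (λ _ → 1#) +ᶠ sum from     ≈⟨ ∑-distrib-+ (λ _ → 1#) from ⟨
    sum (λ i → 1# +ᶠ from i)           ≈⟨ sum-reindex +-commutativeMonoid (1# +ᶠ_) (- 1# +ᶠ_) +-congˡ +-congˡ
                                            (cancel (-‿inverseʳ 1#)) (cancel (-‿inverseˡ 1#)) (λ x → x) (λ eq → eq) ⟨
    sum from                           ≈⟨ +-identityˡ _ ⟨
    0# +ᶠ sum from                     ∎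
    where
    open MonoidSum +-commutativeMonoid using (sum; sum-replicate; ∑-distrib-+)
    cancel : ∀ {a b} → a +ᶠ b ≈ 0# → ∀ x → a +ᶠ (b +ᶠ x) ≈ x
    cancel a+b≈0 x = ≈-trans (≈-sym (+-assoc _ _ x)) (≈-trans (+-congʳ a+b≈0) (+-identityˡ x))

  -- The tested value comes last. With `y = 1#` it keeps zero from annihilating a product that runs
  -- over the whole enumeration.
  ifZero : Carrier → Carrier → Carrier → Carrier
  ifZero y z x with x ≟ 0#
  ... | yes _ = y
  ... | no  _ = z

  ifZero-yes : ∀ {x y z} → x ≈ 0# → ifZero y z x ≈ y
  ifZero-yes {x} x≈0 with x ≟ 0#
  ... | yes _   = ≈-refl
  ... | no  x≉0 = contradiction x≈0 x≉0

  ifZero-no : ∀ {x y z} → x ≉ 0# → ifZero y z x ≈ z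
  ifZero-no {x} x≉0 with x ≟ 0#
  ... | yes x≈0 = contradiction x≈0 x≉0
  ... | no  _   = ≈-refl

  -- The argument for Fermat's little theorem. With zero replaced by `1#` (the map `h`), scaling by
  -- `a` permutes the factors of the product, while each nonzero factor gains an `a`, recorded by
  -- `k`. So the product of `k` is `1#`; one more `a` turns it into `a ^ᶠ N`.
  x^N≈x : ∀ {a} → a ≉ 0# → a ^ᶠ N ≈ a
  x^N≈x {a} a≉0 = begin
    a ^ᶠ N               ≈⟨ sum-const-but-one *-commutativeMonoid (to 0#) (k ∘ from)
                              (ifZero-yes (from-to 0#))
                              (λ j j≢ → ifZero-no (λ eq → j≢ (≡.sym (inverseˡ (≈-sym eq)) ))) ⟨
    a *ᶠ prod (k ∘ from) ≈⟨ *-congˡ prod-k≈1 ⟩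
    a *ᶠ 1#              ≈⟨ *-identityʳ a ⟩
    a                    ∎
    where
    open MonoidSum *-commutativeMonoid using (∑-distrib-+; sum-cong-≋) renaming (sum to prod)
    k h : Carrier → Carrier
    k = ifZero 1# a
    h x = ifZero 1# x x

    h-cong : ∀ {x y} → x ≈ y → h x ≈ h y
    h-cong {x} {y} x≈y with x ≟ 0#
    ... | yes x≈0 = ≈-sym (ifZero-yes (≈-trans (≈-sym x≈y) x≈0))
    ... | no  x≉0 = ≈-trans x≈y (≈-sym (ifZero-no (x≉0 ∘ ≈-trans x≈y)))

    h-nonzero : ∀ x → h x ≉ 0#
    h-nonzero x with x ≟ 0#
    ... | yes _   = 0≉1 ∘ ≈-sym
    ... | no  x≉0 = x≉0

    h[ax]≈k[x]h[x] : ∀ x → h (a *ᶠ x) ≈ k x *ᶠ h x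
    h[ax]≈k[x]h[x] x with x ≟ 0#
    ... | yes x≈0 = ≈-trans (ifZero-yes (≈-trans (*-congˡ x≈0) (zeroʳ a))) (≈-sym (*-identityˡ 1#))
    ... | no  x≉0 = ifZero-no (*-nonzero a≉0 x≉0)

    prod-nonzero : ∀ {n} (t : Vector Carrier n) → (∀ i → t i ≉ 0#) → prod t ≉ 0#
    prod-nonzero {zero}  t t≉0 = 0≉1 ∘ ≈-sym
    prod-nonzero {suc n} t t≉0 = *-nonzero (t≉0 zero) (prod-nonzero (t ∘ suc) (t≉0 ∘ suc))

    cancel : ∀ {a b} → a *ᶠ b ≈ 1# → ∀ x → a *ᶠ (b *ᶠ x) ≈ x
    cancel ab≈1 x = ≈-trans (≈-sym (*-assoc _ _ x)) (≈-trans (*-congʳ ab≈1) (*-identityˡ x))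

    prod-k≈1 : prod (k ∘ from) ≈ 1#
    prod-k≈1 = *-cancelʳ (prod-nonzero (h ∘ from) (h-nonzero ∘ from)) $ begin
      prod (k ∘ from) *ᶠ prod (h ∘ from)   ≈⟨ ∑-distrib-+ (k ∘ from) (h ∘ from) ⟨
      prod (λ i → k (from i) *ᶠ h (from i)) ≈⟨ sum-cong-≋ (λ i → h[ax]≈k[x]h[x] (from i)) ⟨
      prod (λ i → h (a *ᶠ from i))         ≈⟨ sum-reindex *-commutativeMonoid (a *ᶠ_) (a ⁻¹ *ᶠ_) *-congˡ *-congˡ
                                                (cancel (⁻¹-inverse a a≉0))
                                                (cancel (≈-trans (*-comm _ _) (⁻¹-inverse a a≉0))) h h-cong ⟨
      prod (h ∘ from)                      ≈⟨ *-identityˡ _ ⟨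
      1# *ᶠ prod (h ∘ from)                ∎

  -- The characteristic and additivity of Frobenius

  ×1-homo-^ : ∀ m k → (m ℕ.^ k) ×ₙ 1# ≈ (m ×ₙ 1#) ^ᶠ k
  ×1-homo-^ m zero    = +-identityʳ 1#
  ×1-homo-^ m (suc k) = ≈-trans (×1-homo-* m (m ℕ.^ k)) (*-congˡ (×1-homo-^ m k))

  ∣⇒×≈0 : ∀ {p m} → p ×ₙ 1# ≈ 0# → p ∣ m → ∀ x → m ×ₙ x ≈ 0#
  ∣⇒×≈0 {p} p×1≈0 (divides k ≡.refl) x = begin
    (k ℕ.* p) ×ₙ x         ≈⟨ ×-congʳ (k ℕ.* p) (*-identityˡ x) ⟨
    (k ℕ.* p) ×ₙ (1# *ᶠ x) ≈⟨ ×-assoc-* (k ℕ.* p) 1# x ⟨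
    (k ℕ.* p) ×ₙ 1# *ᶠ x   ≈⟨ *-congʳ (×1-homo-* k p) ⟩
    (k ×ₙ 1# *ᶠ p ×ₙ 1#) *ᶠ x ≈⟨ *-congʳ (*-congˡ p×1≈0) ⟩
    (k ×ₙ 1# *ᶠ 0#) *ᶠ x   ≈⟨ *-congʳ (zeroʳ _) ⟩
    0# *ᶠ x                ≈⟨ zeroˡ x ⟩
    0#                     ∎

  sum-ends : ∀ {n} (t : Vector Carrier (suc (suc n))) →
             (∀ (i : Fin n) → t (suc (inject₁ i)) ≈ 0#) →
             MonoidSum.sum +-commutativeMonoid t ≈ t zero +ᶠ t (suc (fromℕ n))
  sum-ends {n} t t≈0 = +-congˡ $ begin
    sum (t ∘ suc)                                          ≈⟨ sum-init-last (t ∘ suc) ⟩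
    sum (λ i → t (suc (inject₁ i))) +ᶠ t (suc (fromℕ n))   ≈⟨ +-congʳ (sum-cong-≋ t≈0) ⟩
    sum {n} (λ _ → 0#) +ᶠ t (suc (fromℕ n))                ≈⟨ +-congʳ (sum-replicate-zero n) ⟩
    0# +ᶠ t (suc (fromℕ n))                                ≈⟨ +-identityˡ _ ⟩
    t (suc (fromℕ n))                                      ∎
    where open MonoidSum +-commutativeMonoid using (sum; sum-init-last; sum-cong-≋; sum-replicate-zero)

  frobenius : ∀ {p} → Prime p → p ×ₙ 1# ≈ 0# → ∀ x y → (x +ᶠ y) ^ᶠ p ≈ x ^ᶠ p +ᶠ y ^ᶠ p
  frobenius {zero} pr = ⊥-elim (ℕ.≢-nonZero⁻¹ 0 ⦃ prime⇒nonZero pr ⦄ ≡.refl)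
  frobenius {p@(suc p-1)} pr p×1≈0 x y = begin
    (x +ᶠ y) ^ᶠ p                     ≈⟨ theorem p x y ⟩
    binomialExpansion x y p           ≈⟨ sum-ends (term p) middle ⟩
    term p zero +ᶠ term p (fromℕ p)   ≈⟨ +-cong first last ⟩
    y ^ᶠ p +ᶠ x ^ᶠ p                  ≈⟨ +-comm _ _ ⟩
    x ^ᶠ p +ᶠ y ^ᶠ p                  ∎
    where
    open Binomial commutativeSemiring using (theorem; binomialExpansion)
    term = Binomial.binomialTerm commutativeSemiring x y

    first : term p zero ≈ y ^ᶠ p
    first = ≈-trans (+-identityʳ _) (*-identityˡ _)

    middle : ∀ (i : Fin p-1) → term p (suc (inject₁ i)) ≈ 0#
    middle i = ∣⇒×≈0 p×1≈0 (prime∣pCk pr z<s (s≤s i<p-1)) _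
      where
      i<p-1 : toℕ (inject₁ i) < p-1
      i<p-1 = ≡.subst (_< p-1) (≡.sym (Fin.toℕ-inject₁ i)) (Fin.toℕ<n i)

    last : term p (fromℕ p) ≈ x ^ᶠ p
    last rewrite Fin.toℕ-fromℕ p-1 | nCn≡1 p | ℕ.n∸n≡0 p-1 = ≈-trans (+-identityʳ _) (*-identityʳ _)

  frobenius-^ : ∀ {p} → Prime p → p ×ₙ 1# ≈ 0# → ∀ k x y →
                (x +ᶠ y) ^ᶠ (p ℕ.^ k) ≈ x ^ᶠ (p ℕ.^ k) +ᶠ y ^ᶠ (p ℕ.^ k)
  frobenius-^ pr p×1≈0 zero    x y = distribʳ 1# x y
  frobenius-^ {p} pr p×1≈0 (suc k) x y = begin
    (x +ᶠ y) ^ᶠ (p ℕ.* pᵏ)                     ≈⟨ ^-assocʳ (x +ᶠ y) p pᵏ ⟨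
    ((x +ᶠ y) ^ᶠ p) ^ᶠ pᵏ                      ≈⟨ ^-congˡ pᵏ (frobenius pr p×1≈0 x y) ⟩
    (x ^ᶠ p +ᶠ y ^ᶠ p) ^ᶠ pᵏ                   ≈⟨ frobenius-^ pr p×1≈0 k _ _ ⟩
    (x ^ᶠ p) ^ᶠ pᵏ +ᶠ (y ^ᶠ p) ^ᶠ pᵏ           ≈⟨ +-cong (^-assocʳ x p pᵏ) (^-assocʳ y p pᵏ) ⟩
    x ^ᶠ (p ℕ.* pᵏ) +ᶠ y ^ᶠ (p ℕ.* pᵏ)         ∎
    where pᵏ = p ℕ.^ k

  -- Since `N` is a power of `q` and `q` a power of `p`, the relation `N ×ₙ 1# ≈ 0#` says that a
  -- power of a power of `p ×ₙ 1#` is zero. A field has no nilpotents, so the characteristic is `p`.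
  frobenius-primePower : ∀ {q j} → IsPrimePower q → N ≡ q ℕ.^ j → ∀ x y → (x +ᶠ y) ^ᶠ q ≈ x ^ᶠ q +ᶠ y ^ᶠ q
  frobenius-primePower {q} {j} (p , k , pr , _ , ≡.refl) N≡qʲ =
    frobenius-^ pr (^≈0⇒≈0 k (≈-trans (≈-sym (×1-homo-^ p k)) q×1≈0)) k
    where
    q×1≈0 : q ×ₙ 1# ≈ 0#
    q×1≈0 = ^≈0⇒≈0 j (≈-trans (≈-sym (×1-homo-^ q j)) (≡.subst (λ n → n ×ₙ 1# ≈ 0#) N≡qʲ N×1≈0))

  -- Elements of coprime exponents

  ^-∣≈1 : ∀ {x m n} → m ∣ n → x ^ᶠ m ≈ 1# → x ^ᶠ n ≈ 1#
  ^-∣≈1 {x} {m} (divides a ≡.refl) xᵐ≈1 = begin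
    x ^ᶠ (a ℕ.* m)   ≈⟨ ^-congʳ x (ℕ.*-comm a m) ⟩
    x ^ᶠ (m ℕ.* a)   ≈⟨ ^-assocʳ x m a ⟨
    (x ^ᶠ m) ^ᶠ a    ≈⟨ ^-congˡ a xᵐ≈1 ⟩
    1# ^ᶠ a          ≈⟨ 1^n≈1 a ⟩
    1#               ∎

  -- This is the form in which Bézout's identity is available over the naturals; negative exponents
  -- are avoided by keeping the two multiples on opposite sides.
  ^-combination≈1 : ∀ {x m n} → x ^ᶠ m ≈ 1# → x ^ᶠ n ≈ 1# → ∀ a b → 1 + b ℕ.* n ≡ a ℕ.* m → x ≈ 1#
  ^-combination≈1 {x} {m} {n} xᵐ≈1 xⁿ≈1 a b eq = begin
    x                    ≈⟨ *-identityʳ x ⟨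
    x *ᶠ 1#              ≈⟨ *-congˡ (^-∣≈1 (n∣m*n b) xⁿ≈1) ⟨
    x ^ᶠ (1 + b ℕ.* n)   ≈⟨ ^-congʳ x eq ⟩
    x ^ᶠ (a ℕ.* m)       ≈⟨ ^-∣≈1 (n∣m*n a) xᵐ≈1 ⟩
    1#                   ∎

  ^-coprime≈1 : ∀ {x} m n → gcd m n ≡ 1 → x ^ᶠ m ≈ 1# → x ^ᶠ n ≈ 1# → x ≈ 1#
  ^-coprime≈1 m n gcd≡1 xᵐ≈1 xⁿ≈1
    with Bézout.identity (≡.subst (GCD m n) gcd≡1 (gcd-GCD m n))
  ... | Bézout.+- a b eq = ^-combination≈1 xᵐ≈1 xⁿ≈1 a b eq
  ... | Bézout.-+ a b eq = ^-combination≈1 xⁿ≈1 xᵐ≈1 b a eq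

  -- Evaluation of polynomials

  open FieldTheory F

  eval-cong : ∀ P {x y} → x ≈ y → eval P x ≈ eval P y
  eval-cong []      x≈y = ≈-refl
  eval-cong (a ∷ P) x≈y = +-congˡ (*-cong x≈y (eval-cong P x≈y))

  eval-zero : ∀ {P} → All (_≈ 0#) P → ∀ x → eval P x ≈ 0#
  eval-zero []          x = ≈-refl
  eval-zero (a≈0 ∷ P≈0) x =
    ≈-trans (+-cong a≈0 (≈-trans (*-congˡ (eval-zero P≈0 x)) (zeroʳ x))) (+-identityˡ 0#)

  eval-≋ : ∀ P Q → P ≋ Q → ∀ x → eval P x ≈ eval Q x
  eval-≋ []      []      P≋Q x = ≈-refl
  eval-≋ []      (b ∷ Q) P≋Q x = ≈-sym (≈-trans
    (+-cong (≈-sym (P≋Q 0)) (≈-trans (*-congˡ (≈-sym (eval-≋ [] Q (P≋Q ∘ suc) x))) (zeroʳ x))) (+-identityˡ 0#))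
  eval-≋ (a ∷ P) []      P≋Q x = ≈-trans
    (+-cong (P≋Q 0) (≈-trans (*-congˡ (eval-≋ P [] (P≋Q ∘ suc) x)) (zeroʳ x))) (+-identityˡ 0#)
  eval-≋ (a ∷ P) (b ∷ Q) P≋Q x = +-cong (P≋Q 0) (*-congˡ (eval-≋ P Q (P≋Q ∘ suc) x))

  eval-+ₚ : ∀ P Q x → eval (P +ₚ Q) x ≈ eval P x +ᶠ eval Q x
  eval-+ₚ []      Q       x = ≈-sym (+-identityˡ _)
  eval-+ₚ (a ∷ P) []      x = ≈-sym (+-identityʳ _)
  eval-+ₚ (a ∷ P) (b ∷ Q) x = begin
    (a +ᶠ b) +ᶠ x *ᶠ eval (P +ₚ Q) x             ≈⟨ +-congˡ (*-congˡ (eval-+ₚ P Q x)) ⟩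
    (a +ᶠ b) +ᶠ x *ᶠ (eval P x +ᶠ eval Q x)
      ≈⟨ solve 5 (λ a b x p q → (a :+ b) :+ x :* (p :+ q) := (a :+ x :* p) :+ (b :+ x :* q)) ≈-refl a b x _ _ ⟩
    (a +ᶠ x *ᶠ eval P x) +ᶠ (b +ᶠ x *ᶠ eval Q x) ∎

  eval-·ₚ : ∀ a P x → eval (a ·ₚ P) x ≈ a *ᶠ eval P x
  eval-·ₚ a []      x = ≈-sym (zeroʳ a)
  eval-·ₚ a (b ∷ P) x = begin
    a *ᶠ b +ᶠ x *ᶠ eval (a ·ₚ P) x   ≈⟨ +-congˡ (*-congˡ (eval-·ₚ a P x)) ⟩
    a *ᶠ b +ᶠ x *ᶠ (a *ᶠ eval P x)
      ≈⟨ solve 4 (λ a b x p → a :* b :+ x :* (a :* p) := a :* (b :+ x :* p)) ≈-refl a b x _ ⟩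
    a *ᶠ (b +ᶠ x *ᶠ eval P x)        ∎

  eval-*ₚ : ∀ P Q x → eval (P *ₚ Q) x ≈ eval P x *ᶠ eval Q x
  eval-*ₚ []      Q x = ≈-sym (zeroˡ _)
  eval-*ₚ (a ∷ P) Q x = begin
    eval (a ·ₚ Q +ₚ (0# ∷ P *ₚ Q)) x                    ≈⟨ eval-+ₚ (a ·ₚ Q) _ x ⟩
    eval (a ·ₚ Q) x +ᶠ (0# +ᶠ x *ᶠ eval (P *ₚ Q) x)
      ≈⟨ +-cong (eval-·ₚ a Q x) (≈-trans (+-identityˡ _) (*-congˡ (eval-*ₚ P Q x))) ⟩
    a *ᶠ eval Q x +ᶠ x *ᶠ (eval P x *ᶠ eval Q x)
      ≈⟨ solve 4 (λ a x p q → a :* q :+ x :* (p :* q) := (a :+ x :* p) :* q) ≈-refl a x _ _ ⟩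
    (a +ᶠ x *ᶠ eval P x) *ᶠ eval Q x                    ∎

  eval-∘ₚ : ∀ P Q x → eval (P ∘ₚ Q) x ≈ eval P (eval Q x)
  eval-∘ₚ []      Q x = ≈-refl
  eval-∘ₚ (a ∷ P) Q x = begin
    eval ((a ∷ []) +ₚ Q *ₚ (P ∘ₚ Q)) x              ≈⟨ eval-+ₚ (a ∷ []) (Q *ₚ (P ∘ₚ Q)) x ⟩
    (a +ᶠ x *ᶠ 0#) +ᶠ eval (Q *ₚ (P ∘ₚ Q)) x
      ≈⟨ +-cong (≈-trans (+-congˡ (zeroʳ x)) (+-identityʳ a)) (eval-*ₚ Q (P ∘ₚ Q) x) ⟩
    a +ᶠ eval Q x *ᶠ eval (P ∘ₚ Q) x                ≈⟨ +-congˡ (*-congˡ (eval-∘ₚ P Q x)) ⟩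
    a +ᶠ eval Q x *ᶠ eval P (eval Q x)              ∎

  eval-X^ : ∀ k x → eval (X^ k) x ≈ x ^ᶠ k
  eval-X^ zero    x = ≈-trans (+-congˡ (zeroʳ x)) (+-identityʳ 1#)
  eval-X^ (suc k) x = ≈-trans (+-identityˡ _) (*-congˡ (eval-X^ k x))

  -- An additive power map is also multiplicative and so passes through Horner evaluation. The
  -- exponent has the form `suc k` because the empty list requires `0# ^ᶠ suc k ≈ 0#`.
  eval-⁽⁾ : ∀ k → (∀ x y → (x +ᶠ y) ^ᶠ suc k ≈ x ^ᶠ suc k +ᶠ y ^ᶠ suc k) →
            ∀ P x → eval (P ⁽ suc k ⁾) (x ^ᶠ suc k) ≈ eval P x ^ᶠ suc k
  eval-⁽⁾ k additive []      x = ≈-sym (zeroˡ _)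
  eval-⁽⁾ k additive (a ∷ P) x = begin
    a ^ᶠ suc k +ᶠ x ^ᶠ suc k *ᶠ eval (P ⁽ suc k ⁾) (x ^ᶠ suc k)  ≈⟨ +-congˡ (*-congˡ (eval-⁽⁾ k additive P x)) ⟩
    a ^ᶠ suc k +ᶠ x ^ᶠ suc k *ᶠ eval P x ^ᶠ suc k               ≈⟨ +-congˡ (^-distrib-* x _ (suc k)) ⟨
    a ^ᶠ suc k +ᶠ (x *ᶠ eval P x) ^ᶠ suc k                      ≈⟨ additive a _ ⟨
    (a +ᶠ x *ᶠ eval P x) ^ᶠ suc k                              ∎

  -- Values of reciprocal polynomials

  -- Horner evaluation peels off the constant term, whereas `reciprocal` starts from the top
  -- coefficient; this splits off the top term instead.
  eval-take-suc : ∀ P k x → eval (take (suc k) P) x ≈ eval (take k P) x +ᶠ coeff P k *ᶠ x ^ᶠ k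
  eval-take-suc []      zero    x = ≈-sym (≈-trans (+-identityˡ _) (zeroˡ _))
  eval-take-suc []      (suc k) x = ≈-sym (≈-trans (+-identityˡ _) (zeroˡ _))
  eval-take-suc (a ∷ P) zero    x = begin
    a +ᶠ x *ᶠ 0#    ≈⟨ +-congˡ (zeroʳ x) ⟩
    a +ᶠ 0#         ≈⟨ +-comm a 0# ⟩
    0# +ᶠ a         ≈⟨ +-congˡ (*-identityʳ a) ⟨
    0# +ᶠ a *ᶠ 1#   ∎
  eval-take-suc (a ∷ P) (suc k) x = begin
    a +ᶠ x *ᶠ eval (take (suc k) P) x                          ≈⟨ +-congˡ (*-congˡ (eval-take-suc P k x)) ⟩
    a +ᶠ x *ᶠ (eval (take k P) x +ᶠ coeff P k *ᶠ x ^ᶠ k)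
      ≈⟨ solve 5 (λ a x p c y → a :+ x :* (p :+ c :* y) := (a :+ x :* p) :+ c :* (x :* y)) ≈-refl a x _ _ _ ⟩
    (a +ᶠ x *ᶠ eval (take k P) x) +ᶠ coeff P k *ᶠ (x *ᶠ x ^ᶠ k) ∎

  eval-take : ∀ P n → (∀ i → n ≤ i → coeff P i ≈ 0#) → ∀ x → eval (take n P) x ≈ eval P x
  eval-take P       zero    P≈0 x = eval-≋ [] P (λ i → ≈-sym (P≈0 i z≤n)) x
  eval-take []      (suc n) P≈0 x = ≈-refl
  eval-take (a ∷ P) (suc n) P≈0 x = +-congˡ (*-congˡ (eval-take P n (λ i n≤i → P≈0 (suc i) (s≤s n≤i)) x))

  -- `reciprocal n P` reads only the coefficients up to `n`, so truncation makes the identity valid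
  -- in every degree. The induction works because the tail of `reciprocal (suc n) P` computes to
  -- `reciprocal n P`.
  eval-reciprocal-take : ∀ P n {x y} → x *ᶠ y ≈ 1# → eval (reciprocal n P) x ≈ x ^ᶠ n *ᶠ eval (take (suc n) P) y
  eval-reciprocal-take P zero    {x} {y} xy≈1 = begin
    coeff P 0 +ᶠ x *ᶠ 0#                                   ≈⟨ +-congˡ (zeroʳ x) ⟩
    coeff P 0 +ᶠ 0#
      ≈⟨ solve 2 (λ p z → p :+ z := z :+ p) ≈-refl _ _ ⟩
    0# +ᶠ coeff P 0                                        ≈⟨ +-congˡ (*-identityʳ _) ⟨
    0# +ᶠ coeff P 0 *ᶠ 1#                                  ≈⟨ eval-take-suc P 0 y ⟨
    eval (take 1 P) y                                      ≈⟨ *-identityˡ _ ⟨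
    1# *ᶠ eval (take 1 P) y                                ∎
  eval-reciprocal-take P (suc n) {x} {y} xy≈1 = begin
    c₁ +ᶠ x *ᶠ eval (reciprocal n P) x                      ≈⟨ +-cong (≈-sym (*-identityˡ c₁)) (*-congˡ (eval-reciprocal-take P n xy≈1)) ⟩
    1# *ᶠ c₁ +ᶠ x *ᶠ (x ^ᶠ n *ᶠ T)                          ≈⟨ +-congʳ (*-congʳ xⁿyⁿ≈1) ⟨
    (x ^ᶠ suc n *ᶠ y ^ᶠ suc n) *ᶠ c₁ +ᶠ x *ᶠ (x ^ᶠ n *ᶠ T)
      ≈⟨ solve 5 (λ x xⁿ y c t → ((x :* xⁿ) :* y) :* c :+ x :* (xⁿ :* t) := (x :* xⁿ) :* (t :+ c :* y)) ≈-refl x (x ^ᶠ n) (y ^ᶠ suc n) c₁ T ⟩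
    x ^ᶠ suc n *ᶠ (T +ᶠ c₁ *ᶠ y ^ᶠ suc n)                   ≈⟨ *-congˡ (eval-take-suc P (suc n) y) ⟨
    x ^ᶠ suc n *ᶠ eval (take (suc (suc n)) P) y             ∎
    where
    c₁ = coeff P (suc n)
    T  = eval (take (suc n) P) y
    xⁿyⁿ≈1 : x ^ᶠ suc n *ᶠ y ^ᶠ suc n ≈ 1#
    xⁿyⁿ≈1 = ≈-trans (≈-sym (^-distrib-* x y (suc n))) (≈-trans (^-congˡ (suc n) xy≈1) (1^n≈1 (suc n)))

  eval-reciprocal : ∀ P n → (∀ i → n < i → coeff P i ≈ 0#) → ∀ {x y} → x *ᶠ y ≈ 1# →
                    eval (reciprocal n P) x ≈ x ^ᶠ n *ᶠ eval P y
  eval-reciprocal P n P≈0 xy≈1 =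
    ≈-trans (eval-reciprocal-take P n xy≈1) (*-congˡ (eval-take P (suc n) P≈0 _))

  coeff-⁽⁾-zero : ∀ P k i → coeff P i ≈ 0# → coeff (P ⁽ suc k ⁾) i ≈ 0#
  coeff-⁽⁾-zero []      k i       eq = ≈-refl
  coeff-⁽⁾-zero (a ∷ P) k zero    eq = ≈-trans (*-congʳ eq) (zeroˡ _)
  coeff-⁽⁾-zero (a ∷ P) k (suc i) eq = coeff-⁽⁾-zero P k i eq

  -- Root counting

  -- For any constant a, quotient r P is (A(x) - A(r)) / (x - r) where A = a ∷ P.
  quotient : Carrier → Poly → Poly
  quotient r []      = []
  quotient r (b ∷ P) = eval (b ∷ P) r ∷ quotient r P

  length-quotient : ∀ r P → length (quotient r P) ≡ length P
  length-quotient r []      = ≡.refl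
  length-quotient r (b ∷ P) = ≡.cong suc (length-quotient r P)

  -- Both sides are moved so that no subtraction occurs, which makes this a semiring identity.
  eval-quotient : ∀ r P x → x *ᶠ eval P x +ᶠ r *ᶠ eval (quotient r P) x ≈ r *ᶠ eval P r +ᶠ x *ᶠ eval (quotient r P) x
  eval-quotient r []      x = solve 3 (λ x r z → x :* z :+ r :* z := r :* z :+ x :* z) ≈-refl x r 0#
  eval-quotient r (b ∷ P) x = begin
    x *ᶠ (b +ᶠ x *ᶠ p) +ᶠ r *ᶠ (b +ᶠ r *ᶠ p′ +ᶠ x *ᶠ Q)
      ≈⟨ solve 6 (λ x r b p p′ Q → x :* (b :+ x :* p) :+ r :* (b :+ r :* p′ :+ x :* Q)
                                := x :* b :+ r :* (b :+ r :* p′) :+ x :* (x :* p :+ r :* Q)) ≈-refl x r b p p′ Q ⟩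
    x *ᶠ b +ᶠ r *ᶠ (b +ᶠ r *ᶠ p′) +ᶠ x *ᶠ (x *ᶠ p +ᶠ r *ᶠ Q)    ≈⟨ +-congˡ (*-congˡ (eval-quotient r P x)) ⟩
    x *ᶠ b +ᶠ r *ᶠ (b +ᶠ r *ᶠ p′) +ᶠ x *ᶠ (r *ᶠ p′ +ᶠ x *ᶠ Q)
      ≈⟨ solve 5 (λ x r b p′ Q → x :* b :+ r :* (b :+ r :* p′) :+ x :* (r :* p′ :+ x :* Q)
                              := r :* (b :+ r :* p′) :+ x :* (b :+ r :* p′ :+ x :* Q)) ≈-refl x r b p′ Q ⟩
    r *ᶠ (b +ᶠ r *ᶠ p′) +ᶠ x *ᶠ (b +ᶠ r *ᶠ p′ +ᶠ x *ᶠ Q)        ∎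
    where
    p  = eval P x
    p′ = eval P r
    Q  = eval (quotient r P) x

  -- Synthetic division is triangular: each entry is a coefficient plus `r` times a value of the
  -- tail, and the tail is already known to vanish.
  quotient≈0⇒≈0 : ∀ r P → All (_≈ 0#) (quotient r P) → All (_≈ 0#) P
  quotient≈0⇒≈0 r []      []           = []
  quotient≈0⇒≈0 r (b ∷ P) (e≈0 ∷ Q≈0) = ≈-trans (≈-sym b+rP≈b) e≈0 ∷ P≈0
    where
    P≈0 = quotient≈0⇒≈0 r P Q≈0
    b+rP≈b : b +ᶠ r *ᶠ eval P r ≈ b
    b+rP≈b = ≈-trans (+-congˡ (≈-trans (*-congˡ (eval-zero P≈0 r)) (zeroʳ r))) (+-identityʳ b)

  -- Dividing by `x - z zero` shortens the polynomial by one coefficient and keeps the other roots.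
  -- Bounding the length of the list rather than the degree lets the induction ignore whether
  -- leading coefficients vanish.
  roots⇒zero : ∀ {m} (P : Poly) → length P ≤ m → (z : Fin m → Carrier) → Injective _≡_ _≈_ z →
               (∀ i → eval P (z i) ≈ 0#) → All (_≈ 0#) P
  roots⇒zero []      _         z z-injective roots = []
  roots⇒zero {suc m} (a ∷ P) (s≤s ∣P∣≤m) z z-injective roots = a≈0 ∷ P≈0
    where
    r = z zero
    Q = quotient r P

    root : ∀ i → eval Q (z (suc i)) ≈ 0#
    root i = decidable-stable (_ ≟ 0#) λ Q≉0 →
      contradiction (z-injective (*-cancelʳ Q≉0 rQ≈xQ)) λ ()
      where
      x = z (suc i)
      rQ≈xQ : r *ᶠ eval Q x ≈ x *ᶠ eval Q x
      -- Adding `a` to the quotient identity completes both sides to values of `a ∷ P` at roots,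
      -- which vanish; if `Q` were nonzero at `x`, then `r ≈ x` would follow.
      rQ≈xQ = begin
        r *ᶠ eval Q x                              ≈⟨ +-identityˡ _ ⟨
        0# +ᶠ r *ᶠ eval Q x                        ≈⟨ +-congʳ (roots (suc i)) ⟨
        (a +ᶠ x *ᶠ eval P x) +ᶠ r *ᶠ eval Q x      ≈⟨ +-assoc _ _ _ ⟩
        a +ᶠ (x *ᶠ eval P x +ᶠ r *ᶠ eval Q x)      ≈⟨ +-congˡ (eval-quotient r P x) ⟩
        a +ᶠ (r *ᶠ eval P r +ᶠ x *ᶠ eval Q x)      ≈⟨ +-assoc _ _ _ ⟨
        (a +ᶠ r *ᶠ eval P r) +ᶠ x *ᶠ eval Q x      ≈⟨ +-congʳ (roots zero) ⟩
        0# +ᶠ x *ᶠ eval Q x                        ≈⟨ +-identityˡ _ ⟩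
        x *ᶠ eval Q x                              ∎

    P≈0 : All (_≈ 0#) P
    P≈0 = quotient≈0⇒≈0 r P (roots⇒zero Q
      (≡.subst (_≤ m) (≡.sym (length-quotient r P)) ∣P∣≤m)
      (z ∘ suc) (Fin.suc-injective ∘ z-injective) root)

    a≈0 : a ≈ 0#
    a≈0 = begin
      a                       ≈⟨ +-identityʳ a ⟨
      a +ᶠ 0#                 ≈⟨ +-congˡ (≈-trans (*-congˡ (eval-zero P≈0 r)) (zeroʳ r)) ⟨
      a +ᶠ r *ᶠ eval P r      ≈⟨ roots zero ⟩
      0#                      ∎

  -- The polynomial x + b xᵏ⁺² has too low a degree to vanish on the whole field.
  ∃-x+bx^[2+k]≉0 : ∀ b k → 2 + k < N → ∃[ x ] x +ᶠ b *ᶠ x ^ᶠ (2 + k) ≉ 0#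
  ∃-x+bx^[2+k]≉0 b k 2+k<N = ¬∀⇒∃¬ (λ x → _ ≟ 0#) resp λ vanishes →
    -- The coefficient of `x` is `1#` whatever `b` is, since the other term has degree at least 2.
    0≉1 (≈-sym (All.head (All.tail (roots⇒zero P length≤N from from-injective
      (λ i → ≈-trans (eval-P (from i)) (vanishes (from i)))))))
    where
    P : Poly
    P = 0# ∷ 1# ∷ b ·ₚ X^ k

    length≤N : length P ≤ N
    length≤N = ≡.subst (λ l → 2 + l ≤ N) (≡.sym length-bX^k) (≡.subst (_≤ N) (≡.cong (2 +_) (ℕ.+-comm 1 k)) 2+k<N)
      where
      length-bX^k : length (b ·ₚ X^ k) ≡ k + 1
      length-bX^k = ≡.trans (length-map (b *ᶠ_) (X^ k))
        (≡.trans (length-++ (replicate k 0#)) (≡.cong (_+ 1) (length-replicate k)))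

    resp : ∀ {x y} → x ≈ y → x +ᶠ b *ᶠ x ^ᶠ (2 + k) ≈ 0# → y +ᶠ b *ᶠ y ^ᶠ (2 + k) ≈ 0#
    resp x≈y = ≈-trans (≈-sym (+-cong x≈y (*-congˡ (^-congˡ (2 + k) x≈y))))

    eval-P : ∀ x → eval P x ≈ x +ᶠ b *ᶠ x ^ᶠ (2 + k)
    eval-P x = begin
      0# +ᶠ x *ᶠ (1# +ᶠ x *ᶠ eval (b ·ₚ X^ k) x)     ≈⟨ +-identityˡ _ ⟩
      x *ᶠ (1# +ᶠ x *ᶠ eval (b ·ₚ X^ k) x)
        ≈⟨ *-congˡ (+-congˡ (*-congˡ (≈-trans (eval-·ₚ b (X^ k) x) (*-congˡ (eval-X^ k x))))) ⟩
      x *ᶠ (1# +ᶠ x *ᶠ (b *ᶠ x ^ᶠ k))                ≈⟨ distribˡ x 1# _ ⟩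
      x *ᶠ 1# +ᶠ x *ᶠ (x *ᶠ (b *ᶠ x ^ᶠ k))
        ≈⟨ +-cong (*-identityʳ x) (solve 3 (λ x b y → x :* (x :* (b :* y)) := b :* (x :* (x :* y))) ≈-refl x b (x ^ᶠ k)) ⟩
      x +ᶠ b *ᶠ x ^ᶠ (2 + k)                         ∎

  -- Where `x - x^(e+1) = x (1 - x^e)` is nonzero, both factors are; `suc e < N` is the degree
  -- bound.
  ∃-x^e≉1 : ∀ e → 0 < e → suc e < N → ∃[ x ] (x ≉ 0# × x ^ᶠ e ≉ 1#)
  ∃-x^e≉1 e@(suc k) _ 1+e<N with x , x-xᵉ⁺¹≉0 ← ∃-x+bx^[2+k]≉0 (- 1#) k 1+e<N = x , x≉0 , xᵉ≉1
    where
    x≉0 : x ≉ 0#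
    x≉0 x≈0 = x-xᵉ⁺¹≉0 (≈-trans (+-cong x≈0
      (≈-trans (*-congˡ (≈-trans (*-congʳ x≈0) (zeroˡ _))) (zeroʳ _))) (+-identityˡ 0#))

    xᵉ≉1 : x ^ᶠ e ≉ 1#
    xᵉ≉1 xᵉ≈1 = x-xᵉ⁺¹≉0 $ begin
      x +ᶠ - 1# *ᶠ (x *ᶠ x ^ᶠ e)   ≈⟨ +-congˡ (*-congˡ (≈-trans (*-congˡ xᵉ≈1) (*-identityʳ x))) ⟩
      x +ᶠ - 1# *ᶠ x               ≈⟨ +-congˡ (-1*x≈-x x) ⟩
      x - x                        ≈⟨ -‿inverseʳ x ⟩
      0#                           ∎

  -- Comparing powers

  ^-coprime-injective : ∀ {x y} m n → gcd m n ≡ 1 → y ≉ 0# → x ^ᶠ m ≈ y ^ᶠ m → x ^ᶠ n ≈ y ^ᶠ n → x ≈ y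
  ^-coprime-injective {x} {y} m n gcd≡1 y≉0 xᵐ≈yᵐ xⁿ≈yⁿ = begin
    x                    ≈⟨ [x/y]y≈x ⟨
    x / y *ᶠ y           ≈⟨ *-congʳ (^-coprime≈1 m n gcd≡1 (ratio m xᵐ≈yᵐ) (ratio n xⁿ≈yⁿ)) ⟩
    1# *ᶠ y              ≈⟨ *-identityˡ y ⟩
    y                    ∎
    where
    [x/y]y≈x : x / y *ᶠ y ≈ x
    [x/y]y≈x = begin
      x *ᶠ y ⁻¹ *ᶠ y     ≈⟨ solve 3 (λ x y y⁻¹ → x :* y⁻¹ :* y := x :* (y :* y⁻¹)) ≈-refl x y (y ⁻¹) ⟩
      x *ᶠ (y *ᶠ y ⁻¹)   ≈⟨ *-congˡ (⁻¹-inverse y y≉0) ⟩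
      x *ᶠ 1#            ≈⟨ *-identityʳ x ⟩
      x                  ∎

    ratio : ∀ k → x ^ᶠ k ≈ y ^ᶠ k → (x / y) ^ᶠ k ≈ 1#
    ratio k xᵏ≈yᵏ = *-cancelʳ (^-nonzero k y≉0) $ begin
      (x / y) ^ᶠ k *ᶠ y ^ᶠ k   ≈⟨ ^-distrib-* (x / y) y k ⟨
      (x / y *ᶠ y) ^ᶠ k        ≈⟨ ^-congˡ k [x/y]y≈x ⟩
      x ^ᶠ k                   ≈⟨ xᵏ≈yᵏ ⟩
      y ^ᶠ k                   ≈⟨ *-identityˡ _ ⟨
      1# *ᶠ y ^ᶠ k             ∎

  ^-% : ∀ {u} k → u ^ᶠ suc k ≈ 1# → ∀ a → u ^ᶠ a ≈ u ^ᶠ (a % suc k)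
  ^-% {u} k uᵏ⁺¹≈1 a = begin
    u ^ᶠ a                                      ≈⟨ ^-congʳ u (m≡m%n+[m/n]*n a (suc k)) ⟩
    u ^ᶠ (a % suc k + (a ℕ./ suc k) ℕ.* suc k)  ≈⟨ ^-homo-* u (a % suc k) _ ⟩
    u ^ᶠ (a % suc k) *ᶠ u ^ᶠ ((a ℕ./ suc k) ℕ.* suc k)
      ≈⟨ *-congˡ (^-∣≈1 (n∣m*n (a ℕ./ suc k)) uᵏ⁺¹≈1) ⟩
    u ^ᶠ (a % suc k) *ᶠ 1#                      ≈⟨ *-identityʳ _ ⟩
    u ^ᶠ (a % suc k)                            ∎

-- The field with `q ^ 2` elements and its `(q+1)`-th roots of unity

module PermutationCriterion (t : ℕ) (q-primePower : IsPrimePower (2 + t))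
                            (F : FiniteField c ℓ ((2 + t) ^ 2)) where
  open FiniteField F
    renaming (_^_ to _^ᶠ_; _+_ to _+ᶠ_; _*_ to _*ᶠ_; refl to ≈-refl; sym to ≈-sym; trans to ≈-trans; zero to *-zero)
  open FieldTheory F
  open FiniteFieldProperties F
  open Reasoning
  open Exp commutativeSemiring using (^-congˡ; ^-congʳ; ^-homo-*; ^-assocʳ; ^-distrib-*)
  open SemiringSolver commutativeSemiring using (solve; _:=_; _:+_; _:*_)

  -- With `q` of the form `2 + t`, `q ∸ 1` computes to `m` and `x ^ᶠ q` unfolds to `x *ᶠ x ^ᶠ m`;
  -- several cancellations below rely on this unfolding.
  q m : ℕ
  q = 2 + t
  m = 1 + t

  q²≡1+m[1+q] : q ^ 2 ≡ suc (m ℕ.* suc q)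
  q²≡1+m[1+q] = +-*-Solver.solve 1
    (λ t → (con 2 :+′ t) :^ 2 :=′ con 1 :+′ (con 1 :+′ t) :*′ (con 3 :+′ t)) ≡.refl t
    where open +-*-Solver using (con; _:^_) renaming (_:+_ to _:+′_; _:*_ to _:*′_; _:=_ to _:=′_)

  q<q² : q < q ^ 2
  q<q² = ≡.subst (q <_) (≡.sym q²≡1+m[1+q]) (s≤s (ℕ.≤-trans (ℕ.n≤1+n q) (ℕ.m≤n*m (suc q) m)))

  [x^q]^q≈x : ∀ x → (x ^ᶠ q) ^ᶠ q ≈ x
  [x^q]^q≈x x = ≈-trans (^-assocʳ x q q) (≈-trans (^-congʳ x (≡.cong (q ℕ.*_) (≡.sym (ℕ.*-identityʳ q)))) x^q²≈x)
    where
    x^q²≈x : x ^ᶠ (q ^ 2) ≈ x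
    x^q²≈x with x ≟ 0#
    ... | yes x≈0 = ≈-trans (*-congʳ x≈0) (≈-trans (zeroˡ _) (≈-sym x≈0))
    ... | no  x≉0 = x^N≈x x≉0

  x^m[1+q]≈1 : ∀ {x} → x ≉ 0# → x ^ᶠ (m ℕ.* suc q) ≈ 1#
  x^m[1+q]≈1 {x} x≉0 = *-cancelˡ x≉0 $ begin
    x ^ᶠ suc (m ℕ.* suc q)   ≈⟨ ^-congʳ x q²≡1+m[1+q] ⟨
    x ^ᶠ (q ^ 2)             ≈⟨ x^N≈x x≉0 ⟩
    x                        ≈⟨ *-identityʳ x ⟨
    x *ᶠ 1#                  ∎

  ^m∈μ : ∀ {x} → x ≉ 0# → μ (suc q) (x ^ᶠ m)
  ^m∈μ {x} x≉0 = ≈-trans (^-assocʳ x m (suc q)) (x^m[1+q]≈1 x≉0)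

  ^q-additive : ∀ x y → (x +ᶠ y) ^ᶠ q ≈ x ^ᶠ q +ᶠ y ^ᶠ q
  ^q-additive = frobenius-primePower {j = 2} q-primePower ≡.refl

  -- Hilbert 90: x = a + uᑫaᑫ satisfies xᑫ = ux, and some a makes it nonzero.
  ^m-surjective : ∀ {u} → μ (suc q) u → ∃[ x ] (x ≉ 0# × x ^ᶠ m ≈ u)
  ^m-surjective {u} uv≈1 with a , x≉0 ← ∃-x+bx^[2+k]≉0 (u ^ᶠ q) t q<q² = x , x≉0 , xᵐ≈u
    where
    v = u ^ᶠ q
    x = a +ᶠ v *ᶠ a ^ᶠ q

    xᵐ≈u : x ^ᶠ m ≈ u
    xᵐ≈u = *-cancelˡ x≉0 $ begin
      x ^ᶠ q                                ≈⟨ ^q-additive a _ ⟩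
      a ^ᶠ q +ᶠ (v *ᶠ a ^ᶠ q) ^ᶠ q          ≈⟨ +-congˡ (^-distrib-* v (a ^ᶠ q) q) ⟩
      -- The factor `u` emerges because `v ^ᶠ q` is `u` again, Frobenius being an involution, and
      -- because `u *ᶠ v ≈ 1#` is the membership of `u` in `μ (suc q)`.
      a ^ᶠ q +ᶠ v ^ᶠ q *ᶠ (a ^ᶠ q) ^ᶠ q     ≈⟨ +-cong (≈-sym (*-identityˡ _)) (*-cong ([x^q]^q≈x u) ([x^q]^q≈x a)) ⟩
      1# *ᶠ a ^ᶠ q +ᶠ u *ᶠ a                ≈⟨ +-congʳ (*-congʳ uv≈1) ⟨
      (u *ᶠ v) *ᶠ a ^ᶠ q +ᶠ u *ᶠ a
        ≈⟨ solve 4 (λ u v a a^q → (u :* v) :* a^q :+ u :* a := (a :+ v :* a^q) :* u) ≈-refl u v a (a ^ᶠ q) ⟩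
      x *ᶠ u                                ∎

  -- Put `e = (q² - 1) / d`. As `d` is at least 2, `e + 1` is below `q²`, so some nonzero `x` has
  -- `x^e ≠ 1`; then ζ is `x^e`, whose `d`-th power is `x^(q² - 1) = 1`.
  ∃-root-of-unity : ∀ {d} → d ∣ m → d ≢ 1 → ∃[ ζ ] (ζ ≉ 1# × ζ ^ᶠ d ≈ 1#)
  ∃-root-of-unity {0} (divides k m≡k*0) d≢1 =
    contradiction (≡.trans m≡k*0 (ℕ.*-zeroʳ k)) λ ()
  ∃-root-of-unity {1} d∣m d≢1 = contradiction ≡.refl d≢1
  ∃-root-of-unity {d@(suc (suc _))} (divides (suc k) m≡k*d) d≢1 =
    let x , x≉0 , xᵉ≉1 = ∃-x^e≉1 e z<s 1+e<q²
    in x ^ᶠ e , xᵉ≉1 , ≈-trans (^-assocʳ x e d) (≈-trans (^-congʳ x (≡.sym m[1+q]≡e*d)) (x^m[1+q]≈1 x≉0))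
    where
    e = suc k ℕ.* suc q

    m[1+q]≡e*d : m ℕ.* suc q ≡ e ℕ.* d
    m[1+q]≡e*d = ≡.trans (≡.cong (ℕ._* suc q) m≡k*d)
      (+-*-Solver.solve 3 (λ k d q → k :*′ d :*′ q :=′ k :*′ q :*′ d) ≡.refl (suc k) d (suc q))
      where open +-*-Solver using () renaming (_:*_ to _:*′_; _:=_ to _:=′_)

    1+e<q² : suc e < q ^ 2
    1+e<q² = ≡.subst (suc e <_) (≡.sym (≡.trans q²≡1+m[1+q] (≡.cong suc m[1+q]≡e*d)))
      (s≤s (ℕ.m<m*n e d (s≤s (s≤s z≤n))))

  -- The `(q-1)`-th power of f on nonzero elements

  module _ (n r s : ℕ) (0<s : 0 < s)
           (C : Poly) (C-SCR : IsSCR q n C)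
           (B : Poly) (B-noRoot : NoRootIn B (μ (suc q)))
           (h-permutes : Permutes (λ x → (x ^ᶠ r *ᶠ eval (B ⁽ q ⁾) (x ⁻¹)) / eval B x) (μ (suc q)))
           (s≡r+n : s % suc q ≡ (r + n) % suc q) where

    β = proj₁ (proj₂ C-SCR)

    f h : Carrier → Carrier
    f = eval (X^ s *ₚ (B ∘ₚ X^ m) *ₚ (C ∘ₚ X^ m))
    h u = (u ^ᶠ r *ᶠ eval (B ⁽ q ⁾) (u ⁻¹)) / eval B u

    h-injective : ∀ {u v} → μ (suc q) u → μ (suc q) v → h u ≈ h v → u ≈ v
    h-injective {u} {v} u∈μ v∈μ = proj₁ (proj₂ h-permutes) {u , u∈μ} {v , v∈μ}

    f≈ : ∀ x → f x ≈ x ^ᶠ s *ᶠ eval B (x ^ᶠ m) *ᶠ eval C (x ^ᶠ m)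
    f≈ x = begin
      f x                                                            ≈⟨ eval-*ₚ (X^ s *ₚ (B ∘ₚ X^ m)) (C ∘ₚ X^ m) x ⟩
      eval (X^ s *ₚ (B ∘ₚ X^ m)) x *ᶠ eval (C ∘ₚ X^ m) x             ≈⟨ *-congʳ (eval-*ₚ (X^ s) (B ∘ₚ X^ m) x) ⟩
      eval (X^ s) x *ᶠ eval (B ∘ₚ X^ m) x *ᶠ eval (C ∘ₚ X^ m) x
        ≈⟨ *-cong (*-cong (eval-X^ s x) (eval-∘X^ B)) (eval-∘X^ C) ⟩
      x ^ᶠ s *ᶠ eval B (x ^ᶠ m) *ᶠ eval C (x ^ᶠ m)                   ∎
      where
      eval-∘X^ : ∀ P → eval (P ∘ₚ X^ m) x ≈ eval P (x ^ᶠ m)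
      eval-∘X^ P = ≈-trans (eval-∘ₚ P (X^ m) x) (eval-cong P (eval-X^ m x))

    f-cong : ∀ {x y} → x ≈ y → f x ≈ f y
    f-cong = eval-cong (X^ s *ₚ (B ∘ₚ X^ m) *ₚ (C ∘ₚ X^ m))

    f[0]≈0 : ∀ {x} → x ≈ 0# → f x ≈ 0#
    f[0]≈0 {x} x≈0 = begin
      f x                                              ≈⟨ f≈ x ⟩
      x ^ᶠ s *ᶠ eval B (x ^ᶠ m) *ᶠ eval C (x ^ᶠ m)     ≈⟨ *-congʳ (*-congʳ (0^s≈0 0<s)) ⟩
      0# *ᶠ eval B (x ^ᶠ m) *ᶠ eval C (x ^ᶠ m)         ≈⟨ ≈-trans (*-congʳ (zeroˡ _)) (zeroˡ _) ⟩
      0#                                               ∎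
      where
      0^s≈0 : ∀ {s} → 0 < s → x ^ᶠ s ≈ 0#
      0^s≈0 (s≤s _) = ≈-trans (*-congʳ x≈0) (zeroˡ _)

    -- For `u` in `μ (suc q)` the inverse of `u` is `u ^ᶠ q`, an argument at which the conjugated
    -- polynomial takes a `q`-th power as its value.
    eval-conjugate : ∀ P {u} → μ (suc q) u → eval (P ⁽ q ⁾) (u ⁻¹) ≈ eval P u ^ᶠ q
    eval-conjugate P {u} u∈μ = ≈-trans (eval-cong (P ⁽ q ⁾) u⁻¹≈u^q) (eval-⁽⁾ m ^q-additive P u)
      where
      u≉0 = ^≈1⇒≉0 q u∈μ
      u⁻¹≈u^q : u ⁻¹ ≈ u ^ᶠ q
      u⁻¹≈u^q = *-cancelˡ u≉0 (≈-trans (⁻¹-inverse u u≉0) (≈-sym u∈μ))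

    -- The fraction `B(u)^q / B(u)` collapses to `B(u)^(q-1)`, exactly the factor that B contributes
    -- to `f x ^ᶠ m`.
    h≈ : ∀ {u} → μ (suc q) u → h u ≈ u ^ᶠ r *ᶠ eval B u ^ᶠ m
    h≈ {u} u∈μ = begin
      u ^ᶠ r *ᶠ eval (B ⁽ q ⁾) (u ⁻¹) *ᶠ b ⁻¹   ≈⟨ *-congʳ (*-congˡ (eval-conjugate B u∈μ)) ⟩
      u ^ᶠ r *ᶠ (b *ᶠ b ^ᶠ m) *ᶠ b ⁻¹
        ≈⟨ solve 4 (λ x b y z → x :* (b :* y) :* z := (b :* z) :* (x :* y)) ≈-refl (u ^ᶠ r) b (b ^ᶠ m) (b ⁻¹) ⟩
      (b *ᶠ b ⁻¹) *ᶠ (u ^ᶠ r *ᶠ b ^ᶠ m)         ≈⟨ *-congʳ (⁻¹-inverse b (B-noRoot u u∈μ)) ⟩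
      1# *ᶠ (u ^ᶠ r *ᶠ b ^ᶠ m)                  ≈⟨ *-identityˡ _ ⟩
      u ^ᶠ r *ᶠ b ^ᶠ m                          ∎
      where b = eval B u

    -- Reciprocity evaluated at `u` reads `u^n C(u)^q = β C(u)`; one factor `C(u)` is then
    -- cancelled.
    SCR⇒≈β : ∀ {u} → μ (suc q) u → eval C u ≉ 0# → u ^ᶠ n *ᶠ eval C u ^ᶠ m ≈ β
    SCR⇒≈β {u} u∈μ c≉0 = *-cancelˡ c≉0 $ begin
      c₀ *ᶠ (u ^ᶠ n *ᶠ c₀ ^ᶠ m)
        ≈⟨ solve 3 (λ c x y → c :* (x :* y) := x :* (c :* y)) ≈-refl c₀ (u ^ᶠ n) (c₀ ^ᶠ m) ⟩
      u ^ᶠ n *ᶠ c₀ ^ᶠ q                        ≈⟨ *-congˡ (eval-conjugate C u∈μ) ⟨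
      u ^ᶠ n *ᶠ eval (C ⁽ q ⁾) (u ⁻¹)
        ≈⟨ eval-reciprocal (C ⁽ q ⁾) n (λ i n<i → coeff-⁽⁾-zero C m i (proj₂ (proj₁ C-SCR) i n<i))
             (⁻¹-inverse u (^≈1⇒≉0 q u∈μ)) ⟨
      eval (reciprocal n (C ⁽ q ⁾)) u          ≈⟨ eval-≋ (reciprocal n (C ⁽ q ⁾)) (β ·ₚ C) (proj₂ (proj₂ C-SCR)) u ⟩
      eval (β ·ₚ C) u                          ≈⟨ eval-·ₚ β C u ⟩
      β *ᶠ c₀                                  ≈⟨ *-comm β c₀ ⟩
      c₀ *ᶠ β                                  ∎
      where c₀ = eval C u

    f^m≈hβ : ∀ {x} → x ≉ 0# → eval C (x ^ᶠ m) ≉ 0# → f x ^ᶠ m ≈ h (x ^ᶠ m) *ᶠ β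
    f^m≈hβ {x} x≉0 c≉0 = begin
      f x ^ᶠ m                                       ≈⟨ ^-congˡ m (f≈ x) ⟩
      (x ^ᶠ s *ᶠ b *ᶠ c₀) ^ᶠ m                       ≈⟨ ^-distrib-* _ c₀ m ⟩
      (x ^ᶠ s *ᶠ b) ^ᶠ m *ᶠ c₀ ^ᶠ m                  ≈⟨ *-congʳ (^-distrib-* _ b m) ⟩
      (x ^ᶠ s) ^ᶠ m *ᶠ b ^ᶠ m *ᶠ c₀ ^ᶠ m             ≈⟨ *-congʳ (*-congʳ x^s^m) ⟩
      (u ^ᶠ r *ᶠ u ^ᶠ n) *ᶠ b ^ᶠ m *ᶠ c₀ ^ᶠ m
        ≈⟨ solve 4 (λ x y z w → (x :* y) :* z :* w := (x :* z) :* (y :* w)) ≈-refl (u ^ᶠ r) (u ^ᶠ n) (b ^ᶠ m) (c₀ ^ᶠ m) ⟩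
      (u ^ᶠ r *ᶠ b ^ᶠ m) *ᶠ (u ^ᶠ n *ᶠ c₀ ^ᶠ m)      ≈⟨ *-cong (h≈ u∈μ) (≈-sym (SCR⇒≈β u∈μ c≉0)) ⟨
      h u *ᶠ β                                       ∎
      where
      u  = x ^ᶠ m
      b  = eval B u
      c₀ = eval C u
      u∈μ = ^m∈μ x≉0

      x^s^m : (x ^ᶠ s) ^ᶠ m ≈ u ^ᶠ r *ᶠ u ^ᶠ n
      x^s^m = begin
        (x ^ᶠ s) ^ᶠ m              ≈⟨ ^-assocʳ x s m ⟩
        x ^ᶠ (s ℕ.* m)             ≈⟨ ^-congʳ x (ℕ.*-comm s m) ⟩
        x ^ᶠ (m ℕ.* s)             ≈⟨ ^-assocʳ x m s ⟨
        -- The base is now a `(q+1)`-th root of unity, so its exponent counts only modulo `suc q`.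
        u ^ᶠ s                     ≈⟨ ^-% q u∈μ s ⟩
        u ^ᶠ (s % suc q)           ≈⟨ ^-congʳ u s≡r+n ⟩
        u ^ᶠ ((r + n) % suc q)     ≈⟨ ^-% q u∈μ (r + n) ⟨
        u ^ᶠ (r + n)               ≈⟨ ^-homo-* u r n ⟩
        u ^ᶠ r *ᶠ u ^ᶠ n           ∎

    -- Sufficiency of the two conditions

    module _ (gcd≡1 : gcd s m ≡ 1) (C-noRoot : NoRootIn C (μ (suc q))) where

      f-nonzero : ∀ {x} → x ≉ 0# → f x ≉ 0#
      f-nonzero {x} x≉0 = *-nonzero (*-nonzero (^-nonzero s x≉0) (B-noRoot _ u∈μ)) (C-noRoot _ u∈μ) ∘ ≈-trans (≈-sym (f≈ x))
        where u∈μ = ^m∈μ x≉0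

      f-injective-nonzero : ∀ {x y} → x ≉ 0# → y ≉ 0# → f x ≈ f y → x ≈ y
      f-injective-nonzero {x} {y} x≉0 y≉0 fx≈fy = ^-coprime-injective s m gcd≡1 y≉0 xˢ≈yˢ u≈v
        where
        u = x ^ᶠ m
        v = y ^ᶠ m
        u∈μ = ^m∈μ x≉0
        v∈μ = ^m∈μ y≉0

        β≉0 : β ≉ 0#
        β≉0 = *-nonzero (^-nonzero n (^≈1⇒≉0 q u∈μ)) (^-nonzero m (C-noRoot u u∈μ)) ∘
              ≈-trans (SCR⇒≈β u∈μ (C-noRoot u u∈μ))

        u≈v : u ≈ v
        u≈v = h-injective u∈μ v∈μ $ *-cancelʳ β≉0 $ begin
          h u *ᶠ β     ≈⟨ f^m≈hβ x≉0 (C-noRoot u u∈μ) ⟨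
          f x ^ᶠ m     ≈⟨ ^-congˡ m fx≈fy ⟩
          f y ^ᶠ m     ≈⟨ f^m≈hβ y≉0 (C-noRoot v v∈μ) ⟩
          h v *ᶠ β     ∎

        xˢ≈yˢ : x ^ᶠ s ≈ y ^ᶠ s
        xˢ≈yˢ = *-cancelʳ (B-noRoot u u∈μ) $ *-cancelʳ (C-noRoot u u∈μ) $ begin
          x ^ᶠ s *ᶠ eval B u *ᶠ eval C u   ≈⟨ f≈ x ⟨
          f x                              ≈⟨ fx≈fy ⟩
          f y                              ≈⟨ f≈ y ⟩
          y ^ᶠ s *ᶠ eval B v *ᶠ eval C v   ≈⟨ *-cong (*-congˡ (eval-cong B u≈v)) (eval-cong C u≈v) ⟨
          y ^ᶠ s *ᶠ eval B u *ᶠ eval C u   ∎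

      -- The power identity concerns nonzero arguments. Zero is separated from them because f
      -- vanishes there, by `0 < s`, and nowhere else.
      f-injective : ∀ {x y} → f x ≈ f y → x ≈ y
      f-injective {x} {y} fx≈fy with x ≟ 0# | y ≟ 0#
      ... | yes x≈0 | yes y≈0 = ≈-trans x≈0 (≈-sym y≈0)
      ... | yes x≈0 | no  y≉0 = contradiction (≈-trans (≈-sym fx≈fy) (f[0]≈0 x≈0)) (f-nonzero y≉0)
      ... | no  x≉0 | yes y≈0 = contradiction (≈-trans fx≈fy (f[0]≈0 y≈0)) (f-nonzero x≉0)
      ... | no  x≉0 | no  y≉0 = f-injective-nonzero x≉0 y≉0 fx≈fy

      f-permutes : Permutes f U
      f-permutes = _ , f-injective , λ (y , _) →
        let x , fx≈y = injective⇒surjectiveᶠ f f-cong f-injective y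
        in (x , _) , λ z≈x → ≈-trans (f-cong z≈x) fx≈y

    -- Necessity of the two conditions

    module _ (f-injective : ∀ {x y} → f x ≈ f y → x ≈ y) where

      injective⇒coprime : gcd s m ≡ 1
      injective⇒coprime = decidable-stable (gcd s m ℕ.≟ 1) λ gcd≢1 →
        let ζ , ζ≉1 , ζᵈ≈1 = ∃-root-of-unity (gcd[m,n]∣n s m) gcd≢1
            -- f sees its argument only through the `s`-th and `m`-th powers, and both exponents are
            -- multiples of the order bound `gcd s m`.
            ζˢ≈1 = ^-∣≈1 (gcd[m,n]∣m s m) ζᵈ≈1
            ζᵐ≈1ᵐ = ≈-trans (^-∣≈1 (gcd[m,n]∣n s m) ζᵈ≈1) (≈-sym (1^n≈1 m))
        in ζ≉1 $ f-injective $ begin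
          f ζ                                              ≈⟨ f≈ ζ ⟩
          ζ ^ᶠ s *ᶠ eval B (ζ ^ᶠ m) *ᶠ eval C (ζ ^ᶠ m)
            ≈⟨ *-cong (*-cong (≈-trans ζˢ≈1 (≈-sym (1^n≈1 s))) (eval-cong B ζᵐ≈1ᵐ)) (eval-cong C ζᵐ≈1ᵐ) ⟩
          1# ^ᶠ s *ᶠ eval B (1# ^ᶠ m) *ᶠ eval C (1# ^ᶠ m)   ≈⟨ f≈ 1# ⟨
          f 1#                                             ∎

      injective⇒C-noRoot : NoRootIn C (μ (suc q))
      injective⇒C-noRoot u u∈μ Cu≈0 =
        let x , x≉0 , xᵐ≈u = ^m-surjective u∈μ in
        x≉0 $ f-injective $ begin
          f x                                             ≈⟨ f≈ x ⟩
          x ^ᶠ s *ᶠ eval B (x ^ᶠ m) *ᶠ eval C (x ^ᶠ m)    ≈⟨ *-congˡ (≈-trans (eval-cong C xᵐ≈u) Cu≈0) ⟩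
          x ^ᶠ s *ᶠ eval B (x ^ᶠ m) *ᶠ 0#                 ≈⟨ zeroʳ _ ⟩
          0#                                              ≈⟨ f[0]≈0 ≈-refl ⟨
          f 0#                                            ∎

    f-permutes⇔ : Permutes f U ⇔ (gcd s m ≡ 1 × NoRootIn C (μ (suc q)))
    f-permutes⇔ = mk⇔
      (λ (_ , injective , _) → let f-injective = λ {x} {y} → injective {x , _} {y , _} in
        injective⇒coprime f-injective , injective⇒C-noRoot f-injective)
      (λ (gcd≡1 , C-noRoot) → f-permutes gcd≡1 C-noRoot)

-- This excludes `q = 0` and `q = 1`, leaving the shape `2 + t` on which the criterion is built.
primePower>1 : ∀ {q} → IsPrimePower q → 1 < q
primePower>1 (p , suc k , pr , _ , ≡.refl) =
  ℕ.<-≤-trans (ℕ.nonTrivial⇒n>1 p) (ℕ.m≤m*n p (p ^ k))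
  where instance
    _ = prime⇒nonTrivial pr
    _ = prime⇒nonZero pr
    _ = ℕ.m^n≢0 p k

theorem3p2 :
  ∀ {c ℓ} (q : ℕ) → IsPrimePower q →
  (F : FiniteField c ℓ (q ^ 2)) →
  let open FieldTheory F
      module F = FiniteField F
  in
  (n r s : ℕ) → 0 < r → 0 < s →
  (C : Poly) → IsSCR q n C →
  (B : Poly) → NoRootIn B (μ (suc q)) →
  Permutes (λ x → ((x F.^ r) F.* eval (B ⁽ q ⁾) (x F.⁻¹)) F./ eval B x) (μ (suc q)) →
  s % suc q ≡ (r + n) % suc q →
  PermutesField (X^ s *ₚ (B ∘ₚ X^ (q ∸ 1)) *ₚ (C ∘ₚ X^ (q ∸ 1)))
    ⇔ (gcd s (q ∸ 1) ≡ 1 × NoRootIn C (μ (suc q)))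
theorem3p2 0 q-pp = contradiction (primePower>1 q-pp) λ ()
theorem3p2 1 q-pp = contradiction (primePower>1 q-pp) λ { (s≤s ()) }
theorem3p2 (suc (suc t)) q-pp F n r s _ 0<s C C-SCR B B-noRoot h-permutes s≡r+n =
  PermutationCriterion.f-permutes⇔ t q-pp F n r s 0<s C C-SCR B B-noRoot h-permutes s≡r+n
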